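{- Let $a$ and $b$ be positive integers. There exists a graph $G$ with $\gamma^{LD}(G)=a$ and $\gamma^{SLD}(G)=b$ if and only if $0\le b-a\le 2^a-1$.
   Context: Graphs are finite, simple and undirected, and need not be connected. For a vertex $u$, $N(u)$ is its set of neighbours and $N[u]=N(u)\cup\{u\}$. A code is a non-empty subset $C$ of the vertex set $V$; $I(C;u)=N[u]\cap C$. A code $C$ is locating-dominating if for all distinct $u,v\in V\setminus C$ we have $I(C;u)\neq\emptyset$ and $I(C;u)\ne I(C;v)$. A code $C$ is self-locating-dominating if for every $u\in V\setminus C$ we have $I(C;u)\neq\emptyset$ and $\bigcap_{c\in I(C;u)}N[c]=\{u\}$. $\gamma^{LD}(G)$ and $\gamma^{SLD}(G)$ are the minimum sizes of a locating-dominating and a self-locating-dominating code in $G$. -}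

module Defs where

open import Level using (0ℓ)
open import Data.Nat using (ℕ; _≤_)
open import Data.Fin using (Fin)
open import Data.Fin.Subset using (Subset; _∈_; _∉_; _∩_; _∪_; ⁅_⁆; ⋂; ∣_∣; Nonempty)
open import Data.Fin.Subset.Properties using (_∈?_)
open import Data.List using (List; map; filter; allFin)
open import Data.Product using (_×_; ∃-syntax)
open import Data.Vec using (tabulate)
open import Relation.Binary using (Rel; Decidable; Symmetric; Irreflexive)
open import Relation.Binary.PropositionalEquality using (_≡_; _≢_)
open import Relation.Nullary using (does)

record Graph : Set₁ where
  field
    order    : ℕ

  V : Set
  V = Fin order

  field
    _~_      : Rel V 0ℓ
    _~?_     : Decidable _~_
    ~-sym    : Symmetric _~_
    ~-irrefl : Irreflexive _≡_ _~_

module _ (G : Graph) where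
  open Graph G

  N : V → Subset order
  N u = tabulate λ v → does (u ~? v)

  N[_] : V → Subset order
  N[ u ] = N u ∪ ⁅ u ⁆

  I : Subset order → V → Subset order
  I C u = N[ u ] ∩ C

  elements : Subset order → List V
  elements S = filter (_∈? S) (allFin order)

  -- Domination is required of every non-codeword, also when there is only one
  -- of them; distinctness concerns only the separation condition.
  IsLocatingDominating : Subset order → Set
  IsLocatingDominating C =
      Nonempty C
    × (∀ u → u ∉ C → Nonempty (I C u))
    × (∀ u v → u ∉ C → v ∉ C → u ≢ v → I C u ≢ I C v)

  IsSelfLocatingDominating : Subset order → Set
  IsSelfLocatingDominating C =
      Nonempty C
    × (∀ u → u ∉ C → Nonempty (I C u) × ⋂ (map N[_] (elements (I C u))) ≡ ⁅ u ⁆)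

IsMinimumSize : ∀ {n} → (Subset n → Set) → ℕ → Set
IsMinimumSize P k = (∃[ C ] P C × ∣ C ∣ ≡ k) × (∀ C → P C → k ≤ ∣ C ∣)

-- The minima γ^LD and γ^SLD as relations: a graph without vertices has no code,
-- so for it neither is defined.
IsγLD IsγSLD : Graph → ℕ → Set
IsγLD  G k = IsMinimumSize (IsLocatingDominating G) k
IsγSLD G k = IsMinimumSize (IsSelfLocatingDominating G) k

{-# OPTIONS --safe #-}

-- Necessity: a self-locating-dominating code is locating-dominating and the full
-- vertex set is always one, so a ≤ b ≤ n; and n < a + 2 ^ a, because non-codewords
-- have distinct non-empty traces on a locating-dominating code of size a.
--
-- Sufficiency: a vertex u lies in every self-locating-dominating code as soon as
-- it is isolated or N(u) ⊆ N[v] for some v ≠ u. Writing b = a + d, it suffices to find a graph of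
-- order a + d in which every vertex is of this kind and γ^LD = a. If d < 2 ^ (a - 1),
-- add an isolated vertex to a graph for (a - 1 , d). Otherwise any code of size < a
-- is too small for the order, and one takes a clique of codewords c₀ … c_{a-1}
-- together with d further vertices whose traces on it are distinct non-empty sets,
-- among them d₀ = {all c_j} and d_i = {all c_j but c_i} for i > 0. The vertex with
-- trace d_i is joined to every other further vertex whose trace contains c_i, so
-- that it and c_i dominate each other's neighbourhoods, while the vertex with trace
-- d₀ dominates all the other neighbourhoods.
module Submission where

open import Defs
open import Data.Nat as ℕ using (ℕ; zero; suc; z≤n; s≤s; z<s)
import Data.Nat.Properties as ℕₚ
open import Data.Integer using (+_; _-_; _≤_; _⊖_; +≤+)
import Data.Integer.Properties as ℤₚ
open import Data.Bool using (Bool; true; false; _∧_)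
open import Data.Bool.Properties using (∧-zeroʳ)
open import Data.Product using (_×_; ∃-syntax; _,_; proj₁; proj₂)
open import Data.Sum using (_⊎_; inj₁; inj₂; swap; map₂)
open import Data.Sum.Properties using (inj₁-injective; inj₂-injective)
open import Data.Empty using (⊥-elim) renaming (⊥ to Empty)
open import Data.Fin using (Fin; zero; suc; combine; join; splitAt; _↑ˡ_; _↑ʳ_; _≟_)
open import Data.Fin.Properties
  using (combine-injective; combine-surjective; injective⇒≤; any?; ¬∀⟶∃¬;
         splitAt-join; join-splitAt; suc-injective)
open import Data.Fin.Subset
  using (Subset; inside; outside; _∈_; _∉_; _∩_; ⁅_⁆; ⋂; ∁; ⊤; ⊥; ∣_∣; Nonempty)
open import Data.Fin.Subset.Properties
  using (_∈?_; x∈p∩q⁺; x∈p∩q⁻; x∈p∪q⁺; x∈p∪q⁻; x∈⁅x⁆; x∈⁅y⁆⇒x≡y; ∈⊤; ∉⊥; ∣⊤∣≡n; ∣⊥∣≡0;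
         x∉p⇒x∈∁p; x∈∁p⇒x∉p; ⊆-antisym; drop-there)
open import Data.List as List using (List; allFin)
open import Data.List.Relation.Unary.All as All using (All)
import Data.List.Relation.Unary.All.Properties as Allₚ
open import Data.List.Membership.Propositional using () renaming (_∈_ to _∈ˡ_)
open import Data.List.Membership.Propositional.Properties using (∈-filter⁻)
open import Data.Vec using ([]; _∷_; _++_; here; there)
open import Data.Vec.Properties
  using ([]=⇒lookup; lookup⇒[]=; lookup∘tabulate; ∷-injective)
import Data.Vec.Functional as Vector
open import Function using (_∘_; _∋_)
open import Function.Bundles using (_⇔_; mk⇔)
open import Function.Definitions using (Injective)
open import Relation.Binary using (Decidable)
open import Relation.Binary.PropositionalEquality
open import Relation.Nullary using (¬_; yes; no; does; contradiction)
open import Relation.Nullary.Decidable using (dec-true; ¬?; _×-dec_; _⊎-dec_)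

-- Finite subsets

bit : Bool → Fin 2
bit false = zero
bit true  = suc zero

bit-injective : Injective _≡_ _≡_ bit
bit-injective {false} {false} _ = refl
bit-injective {true}  {true}  _ = refl

bit-surjective : ∀ i → ∃[ x ] bit x ≡ i
bit-surjective zero       = false , refl
bit-surjective (suc zero) = true , refl

-- The characteristic vector read as a binary numeral, so that counting subsets becomes counting in
-- `Fin`.
index : ∀ {n} → Subset n → Fin (2 ℕ.^ n)
index []      = zero
index (x ∷ S) = combine (bit x) (index S)

index-injective : ∀ {n} → Injective _≡_ _≡_ (index {n})
index-injective {_} {[]}    {[]}    _  = refl
index-injective {_} {x ∷ S} {y ∷ T} eq =
  let p , q = combine-injective (bit x) (index S) (bit y) (index T) eq
  in cong₂ _∷_ (bit-injective p) (index-injective q)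

index-surjective : ∀ {n} (y : Fin (2 ℕ.^ n)) → ∃[ S ] index {n} S ≡ y
index-surjective {zero}  zero = [] , refl
index-surjective {suc n} y =
  let j , k , eq = combine-surjective {2} {2 ℕ.^ n} y
      x , p      = bit-surjective j
      S , q      = index-surjective {n} k
  in x ∷ S , trans (cong₂ combine p q) eq

-- Pigeonhole: if every index were hit, the chosen preimages would inject `Fin (2 ^ n)` into
-- `Fin m`. As `Hit` is decidable, the contradiction yields an actual missed index.
missing-subset : ∀ {m n} (f : Fin m → Subset n) → m ℕ.< 2 ℕ.^ n →
                 ∃[ S ] (∀ i → f i ≢ S)
missing-subset {m} {n} f m<2ⁿ = subset y , λ i fi≡ → y∉ (i , trans (cong index fi≡) (index-subset y))
  where
  subset : Fin (2 ℕ.^ n) → Subset n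
  subset y = proj₁ (index-surjective y)

  index-subset : ∀ y → index (subset y) ≡ y
  index-subset y = proj₂ (index-surjective {n} y)

  Hit : Fin (2 ℕ.^ n) → Set
  Hit y = ∃[ i ] index (f i) ≡ y

  not-all-hit : ¬ (∀ y → Hit y)
  not-all-hit hit = ℕₚ.<⇒≱ m<2ⁿ (injective⇒≤ {f = proj₁ ∘ hit}
    (λ {x} {y} eq → trans (sym (proj₂ (hit x))) (trans (cong (index ∘ f) eq) (proj₂ (hit y)))))

  missed : ∃[ y ] ¬ Hit y
  missed = ¬∀⟶∃¬ _ Hit (λ y → any? (λ i → index (f i) ≟ y)) not-all-hit

  y = proj₁ missed
  y∉ = proj₂ missed

extend-injection : ∀ {m n} (z : Subset n) (f : Fin m → Subset n) →
  Injective _≡_ _≡_ f → (∀ i → f i ≢ z) → ∀ k → k ℕ.+ m ℕ.< 2 ℕ.^ n →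
  ∃[ g ] Injective _≡_ _≡_ g × (∀ j → g j ≢ z) × (∀ i → ∃[ j ] g j ≡ f i)
extend-injection z f f-inj f≢z zero    _  = f , f-inj , f≢z , λ i → i , refl
extend-injection {m} {n} z f f-inj f≢z (suc k) lt
  with g , g-inj , g≢z , g⊇f ← extend-injection z f f-inj f≢z k (ℕₚ.<-trans (ℕₚ.n<1+n _) lt)
  -- Putting `z` in front of `g` keeps the new set off `z` as well; the enlarged family has
  -- `suc k + m` members, the number that `lt` bounds.
  with S , S-new ← missing-subset (z Vector.∷ g) lt
  = g′ , g′-inj , g′≢z , λ i → suc (proj₁ (g⊇f i)) , proj₂ (g⊇f i)
  where
  g′ : Fin (suc k ℕ.+ m) → Subset n
  g′ = S Vector.∷ g

  g′-inj : Injective _≡_ _≡_ g′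
  g′-inj {zero}  {zero}  _  = refl
  g′-inj {zero}  {suc j} eq = contradiction (sym eq) (S-new (suc j))
  g′-inj {suc i} {zero}  eq = contradiction eq (S-new (suc i))
  g′-inj {suc i} {suc j} eq = cong suc (g-inj eq)

  g′≢z : ∀ i → g′ i ≢ z
  g′≢z zero    eq = S-new zero (sym eq)
  g′≢z (suc i) eq = g≢z i eq

rank : ∀ {n} {C : Subset n} {u} → u ∈ C → Fin ∣ C ∣
rank {C = inside  ∷ C} here      = zero
rank {C = inside  ∷ C} (there p) = suc (rank p)
rank {C = outside ∷ C} (there p) = rank p

rank-injective : ∀ {n} {C : Subset n} {u v} (p : u ∈ C) (q : v ∈ C) → rank p ≡ rank q → u ≡ v
rank-injective {C = inside  ∷ C} here      here      _  = refl
rank-injective {C = inside  ∷ C} (there p) (there q) eq = cong suc (rank-injective p q (suc-injective eq))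
rank-injective {C = outside ∷ C} (there p) (there q) eq = cong suc (rank-injective p q eq)

-- Packs the trace of `S` on `C` into `∣ C ∣` bits, so that there are at most `2 ^ ∣ C ∣` traces.
restrict : ∀ {n} (C : Subset n) → Subset n → Subset ∣ C ∣
restrict []            []      = []
restrict (inside  ∷ C) (x ∷ S) = x ∷ restrict C S
restrict (outside ∷ C) (x ∷ S) = restrict C S

restrict≡⇒∩≡ : ∀ {n} (C S T : Subset n) → restrict C S ≡ restrict C T → S ∩ C ≡ T ∩ C
restrict≡⇒∩≡ []            []      []      _  = refl
restrict≡⇒∩≡ (inside  ∷ C) (x ∷ S) (y ∷ T) eq
  with refl , eq′ ← ∷-injective eq = cong (_ ∷_) (restrict≡⇒∩≡ C S T eq′)
restrict≡⇒∩≡ (outside ∷ C) (x ∷ S) (y ∷ T) eq = cong₂ _∷_ (∧-outside x y) (restrict≡⇒∩≡ C S T eq)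
  where
  ∧-outside : ∀ x y → x ∧ outside ≡ y ∧ outside
  ∧-outside x y = trans (∧-zeroʳ x) (sym (∧-zeroʳ y))

∈⋂ : ∀ {n} {x : Fin n} {Ss : List (Subset n)} → All (x ∈_) Ss → x ∈ ⋂ Ss
∈⋂ All.[]       = ∈⊤
∈⋂ (p All.∷ ps) = x∈p∩q⁺ (p , ∈⋂ ps)

∈-++ˡ : ∀ {m n} {S : Subset m} {T : Subset n} {i} → i ∈ S → i ↑ˡ n ∈ S ++ T
∈-++ˡ here      = here
∈-++ˡ (there p) = there (∈-++ˡ p)

∈-++ʳ⁻ : ∀ {m n} (S : Subset m) {T : Subset n} {i} → m ↑ʳ i ∈ S ++ T → i ∈ T
∈-++ʳ⁻ []      p         = p
∈-++ʳ⁻ (_ ∷ S) (there p) = ∈-++ʳ⁻ S p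

∣++∣ : ∀ {m n} (S : Subset m) (T : Subset n) → ∣ S ++ T ∣ ≡ ∣ S ∣ ℕ.+ ∣ T ∣
∣++∣ []            T = refl
∣++∣ (inside  ∷ S) T = cong suc (∣++∣ S T)
∣++∣ (outside ∷ S) T = ∣++∣ S T

-- Codes in a graph

module _ (G : Graph) where
  open Graph G

  ∈N⁺ : ∀ {u v} → u ~ v → v ∈ N G u
  ∈N⁺ {u} {v} u~v = lookup⇒[]= v (N G u)
    (trans (lookup∘tabulate (λ w → does (u ~? w)) v) (dec-true (u ~? v) u~v))

  ∈N⁻ : ∀ {u v} → v ∈ N G u → u ~ v
  ∈N⁻ {u} {v} v∈N with u ~? v | trans (sym (lookup∘tabulate (λ w → does (u ~? w)) v)) ([]=⇒lookup v∈N)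
  ... | yes u~v | _ = u~v

  ∈N[]⁺ : ∀ {u v} → u ≡ v ⊎ u ~ v → v ∈ N[_] G u
  ∈N[]⁺ (inj₁ refl) = x∈p∪q⁺ (inj₂ (x∈⁅x⁆ _))
  ∈N[]⁺ (inj₂ u~v)  = x∈p∪q⁺ (inj₁ (∈N⁺ u~v))

  ∈N[]⁻ : ∀ {u v} → v ∈ N[_] G u → u ≡ v ⊎ u ~ v
  ∈N[]⁻ {u} v∈ with x∈p∪q⁻ (N G u) ⁅ u ⁆ v∈
  ... | inj₁ v∈N = inj₂ (∈N⁻ v∈N)
  ... | inj₂ v∈u = inj₁ (sym (x∈⁅y⁆⇒x≡y u v∈u))

  ∈I⁺ : ∀ {C u c} → u ~ c → c ∈ C → c ∈ I G C u
  ∈I⁺ u~c c∈C = x∈p∩q⁺ (∈N[]⁺ (inj₂ u~c) , c∈C)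

  ∈I⁻ : ∀ C u {c} → u ∉ C → c ∈ I G C u → u ~ c × c ∈ C
  ∈I⁻ C u u∉C c∈I with x∈p∩q⁻ (N[_] G u) C c∈I
  ... | c∈N , c∈C with ∈N[]⁻ c∈N
  ...   | inj₁ refl = contradiction c∈C u∉C
  ...   | inj₂ u~c  = u~c , c∈C

  -- Without the requirement that codes be non-empty, the empty graph has a code
  -- of size 0, which starts the induction below.
  LocatesAndDominates : Subset order → Set
  LocatesAndDominates C =
      (∀ u → u ∉ C → Nonempty (I G C u))
    × (∀ u v → u ∉ C → v ∉ C → u ≢ v → I G C u ≢ I G C v)

  -- Codewords are labelled by their rank, non-codewords by their traces, which separation makes
  -- distinct.
  order<∣C∣+2^∣C∣ : ∀ C → LocatesAndDominates C → order ℕ.< ∣ C ∣ ℕ.+ 2 ℕ.^ ∣ C ∣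
  order<∣C∣+2^∣C∣ C (dominates , separates) = injective⇒≤ {f = label} label-injective
    where
    trace : V → Subset ∣ C ∣
    trace u = restrict C (N[_] G u)

    code : Fin (suc order) → Fin ∣ C ∣ ⊎ Subset ∣ C ∣
    -- The extra point takes the empty trace, which domination denies to every non-codeword; this
    -- makes the bound strict.
    code zero = inj₂ (restrict C ⊥)
    code (suc u) with u ∈? C
    ... | yes u∈C = inj₁ (rank u∈C)
    ... | no  _   = inj₂ (trace u)

    trace≢⊥ : ∀ {u} → u ∉ C → trace u ≢ restrict C ⊥
    trace≢⊥ {u} u∉C eq with c , c∈I ← dominates u u∉C =
      ∉⊥ (proj₁ (x∈p∩q⁻ ⊥ C (subst (c ∈_) (restrict≡⇒∩≡ C _ ⊥ eq) c∈I)))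

    code-injective : ∀ x y → code x ≡ code y → x ≡ y
    code-injective zero    zero    _  = refl
    code-injective zero    (suc v) eq with v ∈? C
    ... | no v∉C = contradiction (sym (inj₂-injective eq)) (trace≢⊥ v∉C)
    code-injective (suc u) zero    eq with u ∈? C
    ... | no u∉C = contradiction (inj₂-injective eq) (trace≢⊥ u∉C)
    code-injective (suc u) (suc v) eq with u ∈? C | v ∈? C
    ... | yes u∈C | yes v∈C = cong suc (rank-injective u∈C v∈C (inj₁-injective eq))
    ... | no  u∉C | no  v∉C with u ≟ v
    ...   | yes u≡v = cong suc u≡v
    ...   | no  u≢v = contradiction (restrict≡⇒∩≡ C _ _ (inj₂-injective eq)) (separates u v u∉C v∉C u≢v)

    label : Fin (suc order) → Fin (∣ C ∣ ℕ.+ 2 ℕ.^ ∣ C ∣)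
    label x = join _ _ (map₂ index (code x))

    map₂-index-injective : Injective _≡_ _≡_ (map₂ {A = Fin ∣ C ∣} (index {∣ C ∣}))
    map₂-index-injective {inj₁ _} {inj₁ _} eq = cong inj₁ (inj₁-injective eq)
    map₂-index-injective {inj₂ _} {inj₂ _} eq = cong inj₂ (index-injective (inj₂-injective eq))

    label-injective : Injective _≡_ _≡_ label
    label-injective {x} {y} eq = code-injective x y (map₂-index-injective
      (trans (sym (splitAt-join _ _ _)) (trans (cong (splitAt _) eq) (splitAt-join _ _ _))))

  -- The intersection of the `N[ c ]` depends only on the trace, so equal traces force
  -- `⁅ u ⁆ ≡ ⁅ v ⁆`.
  SLD⇒LD : ∀ {C} → IsSelfLocatingDominating G C → IsLocatingDominating G C
  SLD⇒LD (nonempty , sld) = nonempty , (λ u u∉C → proj₁ (sld u u∉C)) , separates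
    where
    separates : ∀ u v → u ∉ _ → v ∉ _ → u ≢ v → I G _ u ≢ I G _ v
    separates u v u∉C v∉C u≢v eq = u≢v (x∈⁅y⁆⇒x≡y v (subst (u ∈_) ⁅u⁆≡⁅v⁆ (x∈⁅x⁆ u)))
      where
      ⁅u⁆≡⁅v⁆ : ⁅ u ⁆ ≡ ⁅ v ⁆
      ⁅u⁆≡⁅v⁆ = trans (sym (proj₂ (sld u u∉C)))
        (trans (cong (λ S → ⋂ (List.map (N[_] G) (elements G S))) eq) (proj₂ (sld v v∉C)))

  ⊤-SLD : V → IsSelfLocatingDominating G ⊤
  ⊤-SLD v = (v , ∈⊤) , λ u u∉⊤ → contradiction ∈⊤ u∉⊤

  -- This is N(u) ⊆ N[v] only: `u` and `v` may be non-adjacent, as c_i and d_i are for i > 0.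
  Dominates : V → V → Set
  Dominates v u = v ≢ u × (∀ w → u ~ w → v ≡ w ⊎ v ~ w)

  Forced : V → Set
  Forced u = (∀ w → ¬ u ~ w) ⊎ ∃[ v ] Dominates v u

  -- If `u ∉ C`, then `I G C u` consists of neighbours of `u`. An isolated `u` has none, and a
  -- dominating `v` lies in every `N[ c ]`, hence in an intersection that should be `⁅ u ⁆`.
  forced∈SLD : ∀ {u C} → Forced u → IsSelfLocatingDominating G C → u ∈ C
  forced∈SLD {u} {C} forced (_ , sld) with u ∈? C
  ... | yes u∈C = u∈C
  ... | no  u∉C with sld u u∉C
  ...   | (c , c∈I) , ⋂≡⁅u⁆ with forced
  ...     | inj₁ isolated = contradiction (proj₁ (∈I⁻ C u u∉C c∈I)) (isolated c)
  ...     | inj₂ (v , v≢u , N⊆N) =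
    contradiction (x∈⁅y⁆⇒x≡y u (subst (v ∈_) ⋂≡⁅u⁆ (∈⋂ (Allₚ.map⁺ (All.tabulate v∈N[c]))))) v≢u
    where
    v∈N[c] : ∀ {c} → c ∈ˡ elements G (I G C u) → v ∈ N[_] G c
    v∈N[c] {c} c∈ with N⊆N c (proj₁ (∈I⁻ C u u∉C (proj₂ (∈-filter⁻ (_∈? I G C u) {xs = allFin order} c∈))))
    ... | inj₁ refl = ∈N[]⁺ (inj₁ refl)
    ... | inj₂ v~c  = ∈N[]⁺ (inj₂ (~-sym v~c))

  order≤SLD : (∀ u → Forced u) → ∀ C → IsSelfLocatingDominating G C → order ℕ.≤ ∣ C ∣
  order≤SLD forced C C-sld = ℕₚ.≤-reflexive (trans (sym (∣⊤∣≡n order)) (cong ∣_∣ ⊤≡C))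
    where
    ⊤≡C : ⊤ ≡ C
    ⊤≡C = ⊆-antisym (λ {u} _ → forced∈SLD (forced u) C-sld) (λ _ → ∈⊤)

-- Pairs realised by a graph

record Realises (a d : ℕ) (G : Graph) : Set where
  open Graph G
  field
    -- With `forced` this fixes γ^SLD: only the full vertex set can be self-locating-dominating.
    order≡   : order ≡ a ℕ.+ d
    forced   : ∀ u → Forced G u
    code     : Subset order
    code-ld  : LocatesAndDominates G code
    ∣code∣≡a : ∣ code ∣ ≡ a
    minimum  : ∀ C → LocatesAndDominates G C → a ℕ.≤ ∣ C ∣

emptyGraph : Graph
emptyGraph = record
  { order    = 0
  ; _~_      = λ _ _ → Empty
  ; _~?_     = λ _ _ → no λ ()
  ; ~-sym    = λ ()
  ; ~-irrefl = λ _ ()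
  }

emptyGraph-realises : Realises 0 0 emptyGraph
emptyGraph-realises = record
  { order≡   = refl
  ; forced   = λ ()
  ; code     = []
  ; code-ld  = (λ ()) , λ ()
  ; ∣code∣≡a = refl
  ; minimum  = λ _ _ → z≤n
  }

-- Adding an isolated vertex

module _ (G : Graph) where
  open Graph G

  -- No constructor mentions `zero`, so it is isolated and its edges vanish by pattern matching.
  data _~⁺_ : Fin (suc order) → Fin (suc order) → Set where
    suc : ∀ {u v} → u ~ v → suc u ~⁺ suc v

  _~⁺?_ : Decidable _~⁺_
  zero  ~⁺? _     = no λ ()
  suc _ ~⁺? zero  = no λ ()
  suc u ~⁺? suc v with u ~? v
  ... | yes u~v = yes (suc u~v)
  ... | no  u≁v = no λ { (suc u~v) → u≁v u~v }

  addIsolated : Graph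
  addIsolated = record
    { order    = suc order
    ; _~_      = _~⁺_
    ; _~?_     = _~⁺?_
    ; ~-sym    = λ { (suc u~v) → suc (~-sym u~v) }
    ; ~-irrefl = λ { refl (suc u~u) → ~-irrefl refl u~u }
    }

  -- With `I⁺-there⁻`: the trace of an old non-codeword is merely shifted, whether or not the new
  -- vertex is a codeword.
  I⁺-there : ∀ x C u {c} → u ∉ C → c ∈ I G C u → suc c ∈ I addIsolated (x ∷ C) (suc u)
  I⁺-there x C u u∉C c∈I with u~c , c∈C ← ∈I⁻ G C u u∉C c∈I = ∈I⁺ addIsolated {x ∷ C} (suc u~c) (there c∈C)

  I⁺-there⁻ : ∀ x C u {c} → u ∉ C → c ∈ I addIsolated (x ∷ C) (suc u) →
              ∃[ c′ ] c ≡ suc c′ × c′ ∈ I G C u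
  I⁺-there⁻ x C u u∉C c∈I with ∈I⁻ addIsolated (x ∷ C) (suc u) (u∉C ∘ drop-there) c∈I
  ... | suc u~c , there c∈C = _ , refl , ∈I⁺ G u~c c∈C

  inside∷-ld : ∀ {C} → LocatesAndDominates G C → LocatesAndDominates addIsolated (inside ∷ C)
  inside∷-ld {C} (dominates , separates) = dominates′ , separates′
    where
    dominates′ : ∀ u → u ∉ inside ∷ C → Nonempty (I addIsolated (inside ∷ C) u)
    dominates′ zero    u∉ = contradiction here u∉
    dominates′ (suc u) u∉ with c , c∈I ← dominates u (u∉ ∘ there) =
      suc c , I⁺-there inside C u (u∉ ∘ there) c∈I

    I⁺-⊆ : ∀ {u v} → u ∉ C → v ∉ C →
           I addIsolated (inside ∷ C) (suc u) ≡ I addIsolated (inside ∷ C) (suc v) →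
           ∀ {c} → c ∈ I G C u → c ∈ I G C v
    I⁺-⊆ {u} {v} u∉C v∉C eq {c} c∈I
      with I⁺-there⁻ inside C v v∉C (subst (suc c ∈_) eq (I⁺-there inside C u u∉C c∈I))
    ... | _ , refl , c∈I′ = c∈I′

    separates′ : ∀ u v → u ∉ inside ∷ C → v ∉ inside ∷ C → u ≢ v →
                 I addIsolated (inside ∷ C) u ≢ I addIsolated (inside ∷ C) v
    separates′ zero    _       u∉ _  _   _  = u∉ here
    separates′ (suc u) zero    _  v∉ _   _  = v∉ here
    separates′ (suc u) (suc v) u∉ v∉ u≢v eq =
      separates u v (u∉ ∘ there) (v∉ ∘ there) (u≢v ∘ cong suc)
        (⊆-antisym (I⁺-⊆ (u∉ ∘ there) (v∉ ∘ there) eq) (I⁺-⊆ (v∉ ∘ there) (u∉ ∘ there) (sym eq)))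

  -- An isolated non-codeword would not be dominated, so every code contains the new vertex. This
  -- raises the minimum by at least one.
  ∷-ld⁻ : ∀ {x C} → LocatesAndDominates addIsolated (x ∷ C) → x ≡ inside × LocatesAndDominates G C
  ∷-ld⁻ {outside} {C} (dominates , _)
    with c , c∈I ← dominates zero (λ ())
    with ∈I⁻ addIsolated (outside ∷ C) zero (λ ()) c∈I
  ... | () , _
  ∷-ld⁻ {inside} {C} (dominates , separates) = refl , dominates′ , separates′
    where
    dominates′ : ∀ u → u ∉ C → Nonempty (I G C u)
    dominates′ u u∉C
      with c , c∈I ← dominates (suc u) (u∉C ∘ drop-there)
      with I⁺-there⁻ inside C u u∉C c∈I
    ... | c′ , _ , c′∈I = c′ , c′∈I

    I-⊆ : ∀ {u v} → u ∉ C → v ∉ C → I G C u ≡ I G C v →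
          ∀ {c} → c ∈ I addIsolated (inside ∷ C) (suc u) → c ∈ I addIsolated (inside ∷ C) (suc v)
    I-⊆ {u} {v} u∉C v∉C eq c∈I with I⁺-there⁻ inside C u u∉C c∈I
    ... | _ , refl , c∈I′ = I⁺-there inside C v v∉C (subst (_ ∈_) eq c∈I′)

    separates′ : ∀ u v → u ∉ C → v ∉ C → u ≢ v → I G C u ≢ I G C v
    separates′ u v u∉C v∉C u≢v eq =
      separates (suc u) (suc v) (u∉C ∘ drop-there) (v∉C ∘ drop-there) (u≢v ∘ suc-injective)
        (⊆-antisym (I-⊆ u∉C v∉C eq) (I-⊆ v∉C u∉C (sym eq)))

  addIsolated-realises : ∀ {a d} → Realises a d G → Realises (suc a) d addIsolated
  addIsolated-realises {a} r = record
    { order≡   = cong suc order≡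
    ; forced   = forced′
    ; code     = inside ∷ code
    ; code-ld  = inside∷-ld code-ld
    ; ∣code∣≡a = cong suc ∣code∣≡a
    ; minimum  = minimum′
    }
    where
    open Realises r

    forced′ : ∀ u → Forced addIsolated u
    forced′ zero = inj₁ λ _ ()
    forced′ (suc u) with forced u
    ... | inj₁ isolated       = inj₁ λ { (suc w) (suc u~w) → isolated w u~w }
    ... | inj₂ (v , v≢u , N⊆N) = inj₂ (suc v , v≢u ∘ suc-injective , N⊆N′)
      where
      N⊆N′ : ∀ w → suc u ~⁺ w → suc v ≡ w ⊎ suc v ~⁺ w
      N⊆N′ (suc w) (suc u~w) with N⊆N w u~w
      ... | inj₁ v≡w = inj₁ (cong suc v≡w)
      ... | inj₂ v~w = inj₂ (suc v~w)

    minimum′ : ∀ C → LocatesAndDominates addIsolated C → suc a ℕ.≤ ∣ C ∣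
    minimum′ (x ∷ C) ld with refl , ld′ ← ∷-ld⁻ ld = s≤s (minimum C ld′)

-- The large graphs

-- The traces d_i. Index `zero` gets the full set instead of a complement, so each of them contains
-- `zero` and is non-empty, even for `n = 1`.
almostFull : ∀ {n} → Fin n → Subset n
almostFull zero    = ⊤
almostFull (suc i) = ∁ ⁅ suc i ⁆

≢⇒∈almostFull : ∀ {n} (i : Fin n) {j} → j ≢ i → j ∈ almostFull i
≢⇒∈almostFull zero    j≢i = ∈⊤
≢⇒∈almostFull (suc i) j≢i = x∉p⇒x∈∁p (j≢i ∘ x∈⁅y⁆⇒x≡y (suc i))

0∈almostFull : ∀ {n} (i : Fin (suc n)) → zero ∈ almostFull i
0∈almostFull zero    = ∈⊤
0∈almostFull (suc i) = ≢⇒∈almostFull (suc i) λ ()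

suc∉almostFull : ∀ {n} (i : Fin n) → suc i ∉ almostFull (suc i)
suc∉almostFull i p = x∈∁p⇒x∉p p (x∈⁅x⁆ (suc i))

-- `suc j` is missing from the set of index `suc j` and from no other.
almostFull-injective : ∀ {n} → Injective _≡_ _≡_ (almostFull {n})
almostFull-injective {_} {zero}  {zero}  _  = refl
almostFull-injective {_} {i}     {suc j} eq with suc j ≟ i
... | yes j≡i = sym j≡i
... | no  j≢i = contradiction (subst (suc j ∈_) eq (≢⇒∈almostFull i j≢i)) (suc∉almostFull j)
almostFull-injective {_} {suc i} {zero}  eq =
  contradiction (subst (suc i ∈_) (sym eq) ∈⊤) (suc∉almostFull i)

-- `δ` records where the sets `almostFull i` occur in `F`; the remaining traces may be any distinct
-- non-empty sets.
module LargeGraph {p m : ℕ}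
  (F : Fin m → Subset (suc p)) (F-injective : Injective _≡_ _≡_ F) (F≢⊥ : ∀ s → F s ≢ ⊥)
  (δ : Fin (suc p) → Fin m) (F-δ : ∀ i → F (δ i) ≡ almostFull i)
  where

  -- inj₁ i is c_i, inj₂ s is the vertex with trace F s, and inj₂ (δ i) the one with trace d_i.
  W : Set
  W = Fin (suc p) ⊎ Fin m

  Arc : Fin m → Fin m → Set
  Arc s t = ∃[ i ] s ≡ δ i × i ∈ F t

  Adj : W → W → Set
  Adj (inj₁ i) (inj₁ j) = i ≢ j
  Adj (inj₁ i) (inj₂ t) = i ∈ F t
  Adj (inj₂ s) (inj₁ j) = j ∈ F s
  -- `Arc` alone has a loop at `δ zero`, whose trace contains `zero`; `s ≢ t` removes it.
  Adj (inj₂ s) (inj₂ t) = s ≢ t × (Arc s t ⊎ Arc t s)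

  Arc? : Decidable Arc
  Arc? s t = any? λ i → (s ≟ δ i) ×-dec (i ∈? F t)

  Adj? : Decidable Adj
  Adj? (inj₁ i) (inj₁ j) = ¬? (i ≟ j)
  Adj? (inj₁ i) (inj₂ t) = i ∈? F t
  Adj? (inj₂ s) (inj₁ j) = j ∈? F s
  Adj? (inj₂ s) (inj₂ t) = ¬? (s ≟ t) ×-dec (Arc? s t ⊎-dec Arc? t s)

  Adj-sym : ∀ x y → Adj x y → Adj y x
  Adj-sym (inj₁ i) (inj₁ j) i≢j       = i≢j ∘ sym
  Adj-sym (inj₁ i) (inj₂ t) i∈        = i∈
  Adj-sym (inj₂ s) (inj₁ j) j∈        = j∈
  Adj-sym (inj₂ s) (inj₂ t) (s≢t , a) = s≢t ∘ sym , swap a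

  Adj-irrefl : ∀ x → ¬ Adj x x
  Adj-irrefl (inj₁ i) i≢i       = i≢i refl
  Adj-irrefl (inj₂ s) (s≢s , _) = s≢s refl

  part : Fin (suc p ℕ.+ m) → W
  part = splitAt (suc p)

  vertex : W → Fin (suc p ℕ.+ m)
  vertex = join (suc p) m

  graph : Graph
  graph = record
    { order    = suc p ℕ.+ m
    ; _~_      = λ u v → Adj (part u) (part v)
    ; _~?_     = λ u v → Adj? (part u) (part v)
    ; ~-sym    = λ {u} {v} → Adj-sym (part u) (part v)
    ; ~-irrefl = λ { {u} refl → Adj-irrefl (part u) }
    }

  full : Fin m
  full = δ zero

  ∈F-full : ∀ {i} → i ∈ F full
  ∈F-full = subst (_ ∈_) (sym (F-δ zero)) ∈⊤

  ≢⇒∈F-δ : ∀ i {j} → j ≢ i → j ∈ F (δ i)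
  ≢⇒∈F-δ i j≢i = subst (_ ∈_) (sym (F-δ i)) (≢⇒∈almostFull i j≢i)

  0∈F-δ : ∀ i → zero ∈ F (δ i)
  0∈F-δ i = subst (zero ∈_) (sym (F-δ i)) (0∈almostFull i)

  δ-injective : Injective _≡_ _≡_ δ
  δ-injective {i} {j} eq = almostFull-injective (trans (sym (F-δ i)) (trans (cong F eq) (F-δ j)))

  δ-adjacent : ∀ i t → i ∈ F t → δ i ≡ t ⊎ Adj (inj₂ (δ i)) (inj₂ t)
  δ-adjacent i t i∈ with δ i ≟ t
  ... | yes δi≡t = inj₁ δi≡t
  ... | no  δi≢t = inj₂ (δi≢t , inj₁ (i , refl , i∈))

  AdjOrEqual : W → W → Set
  AdjOrEqual x y = x ≡ y ⊎ Adj x y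

  -- The other codewords lie in the trace of d_i, which omits at most c_i; the outer neighbours of
  -- c_i are joined to d_i by the choice of arcs.
  c-dominated : ∀ i w → Adj (inj₁ i) w → AdjOrEqual (inj₂ (δ i)) w
  c-dominated i (inj₁ j) i≢j = inj₂ (≢⇒∈F-δ i (i≢j ∘ sym))
  c-dominated i (inj₂ t) i∈ with δ-adjacent i t i∈
  ... | inj₁ refl = inj₁ refl
  ... | inj₂ adj  = inj₂ adj

  δ-dominated : ∀ i w → Adj (inj₂ (δ i)) w → AdjOrEqual (inj₁ i) w
  δ-dominated i (inj₁ j) _ with i ≟ j
  ... | yes refl = inj₁ refl
  ... | no  i≢j  = inj₂ i≢j
  δ-dominated i (inj₂ t) (_ , inj₁ (i′ , eq , i′∈)) =
    inj₂ (subst (_∈ F t) (sym (δ-injective eq)) i′∈)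
  -- Here `t` is `δ j` with `j ≢ i`, so its trace, which misses at most c_j, contains c_i.
  δ-dominated i (inj₂ t) (δi≢t , inj₂ (j , refl , _)) = inj₂ (≢⇒∈F-δ j (δi≢t ∘ cong δ))

  -- No arc leaves `s`, so its outer neighbours all have the form `δ j`; their traces contain c_0,
  -- which joins them to `full` unless they equal it.
  other-dominated : ∀ s → (∀ i → s ≢ δ i) → ∀ w → Adj (inj₂ s) w → AdjOrEqual (inj₂ full) w
  other-dominated s s≢δ (inj₁ j) _ = inj₂ ∈F-full
  other-dominated s s≢δ (inj₂ t) (_ , inj₁ (i , s≡δi , _)) = contradiction s≡δi (s≢δ i)
  other-dominated s s≢δ (inj₂ t) (_ , inj₂ (j , refl , _)) with δ-adjacent zero (δ j) (0∈F-δ j)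
  ... | inj₁ eq  = inj₁ (cong inj₂ eq)
  ... | inj₂ adj = inj₂ adj

  dominated : ∀ x → ∃[ y ] (y ≢ x) × (∀ w → Adj x w → AdjOrEqual y w)
  dominated (inj₁ i) = inj₂ (δ i) , (λ ()) , c-dominated i
  dominated (inj₂ s) with any? (λ i → s ≟ δ i)
  ... | yes (i , refl) = inj₁ i , (λ ()) , δ-dominated i
  ... | no  s≢δ        = inj₂ full , (λ { refl → s≢δ (zero , refl) }) ,
                         other-dominated s (λ i s≡δi → s≢δ (i , s≡δi))

  graph-forced : ∀ u → Forced graph u
  graph-forced u with y , y≢x , N⊆N ← dominated (part u) = inj₂ (vertex y , vy≢u , N⊆N′)
    where
    part-vertex : part (vertex y) ≡ y
    part-vertex = splitAt-join (suc p) m y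

    vy≢u : vertex y ≢ u
    vy≢u eq = y≢x (trans (sym part-vertex) (cong part eq))

    N⊆N′ : ∀ w → Adj (part u) (part w) → vertex y ≡ w ⊎ Adj (part (vertex y)) (part w)
    N⊆N′ w adj with N⊆N (part w) adj
    ... | inj₁ y≡w  = inj₁ (trans (cong vertex y≡w) (join-splitAt (suc p) m w))
    ... | inj₂ adj′ = inj₂ (subst (λ z → Adj z (part w)) (sym part-vertex) adj′)

  codewords : Subset (suc p ℕ.+ m)
  codewords = ⊤ {suc p} ++ ⊥ {m}

  ∣codewords∣ : ∣ codewords ∣ ≡ suc p
  ∣codewords∣ = begin
    ∣ codewords ∣                ≡⟨ ∣++∣ (⊤ {suc p}) (⊥ {m}) ⟩
    ∣ ⊤ {suc p} ∣ ℕ.+ ∣ ⊥ {m} ∣  ≡⟨ cong₂ ℕ._+_ (∣⊤∣≡n (suc p)) (∣⊥∣≡0 m) ⟩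
    suc p ℕ.+ 0                  ≡⟨ ℕₚ.+-identityʳ (suc p) ⟩
    suc p                        ∎
    where open ≡-Reasoning

  vertex-codeword : ∀ i → vertex (inj₁ i) ∈ codewords
  vertex-codeword i = ∈-++ˡ ∈⊤

  vertex-noncodeword : ∀ s → vertex (inj₂ s) ∉ codewords
  vertex-noncodeword s = ∉⊥ ∘ ∈-++ʳ⁻ (⊤ {suc p})

  data NonCodeword : Fin (suc p ℕ.+ m) → Set where
    outer : ∀ s → NonCodeword (vertex (inj₂ s))

  nonCodeword : ∀ u → u ∉ codewords → NonCodeword u
  nonCodeword u u∉ = go (part u) (join-splitAt (suc p) m u)
    where
    go : ∀ x → vertex x ≡ u → NonCodeword u
    go (inj₁ i) refl = contradiction (vertex-codeword i) u∉
    go (inj₂ s) refl = outer s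

  -- With `trace⁻`: the outer vertex `s` has trace `F s` on `codewords`, so non-emptiness and
  -- injectivity of `F` become domination and separation.
  trace⁺ : ∀ s i → i ∈ F s → vertex (inj₁ i) ∈ I graph codewords (vertex (inj₂ s))
  trace⁺ s i i∈ = ∈I⁺ graph
    (subst₂ Adj (sym (splitAt-join (suc p) m (inj₂ s))) (sym (splitAt-join (suc p) m (inj₁ i))) i∈)
    (vertex-codeword i)

  trace⁻ : ∀ s i → vertex (inj₁ i) ∈ I graph codewords (vertex (inj₂ s)) → i ∈ F s
  trace⁻ s i c∈I =
    subst₂ Adj (splitAt-join (suc p) m (inj₂ s)) (splitAt-join (suc p) m (inj₁ i))
      (proj₁ (∈I⁻ graph codewords (vertex (inj₂ s)) (vertex-noncodeword s) c∈I))

  F-nonempty : ∀ s → Nonempty (F s)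
  F-nonempty s with any? (_∈? F s)
  ... | yes p     = p
  ... | no  empty = contradiction
    (⊆-antisym (λ i∈ → ⊥-elim (empty (_ , i∈))) (λ i∈ → ⊥-elim (∉⊥ i∈))) (F≢⊥ s)

  codewords-ld : LocatesAndDominates graph codewords
  codewords-ld = dominates , separates
    where
    dominates : ∀ u → u ∉ codewords → Nonempty (I graph codewords u)
    dominates u u∉ with outer s ← nonCodeword u u∉ with i , i∈ ← F-nonempty s =
      vertex (inj₁ i) , trace⁺ s i i∈

    separates : ∀ u v → u ∉ codewords → v ∉ codewords → u ≢ v →
                I graph codewords u ≢ I graph codewords v
    separates u v u∉ v∉ u≢v eq with outer s ← nonCodeword u u∉ | outer t ← nonCodeword v v∉ =
      u≢v (cong (vertex ∘ inj₂) (F-injective (⊆-antisym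
        (λ {i} i∈ → trace⁻ t i (subst (vertex (inj₁ i) ∈_) eq (trace⁺ s i i∈)))
        (λ {i} i∈ → trace⁻ s i (subst (vertex (inj₁ i) ∈_) (sym eq) (trace⁺ t i i∈))))))

  -- A code with at most `p` elements would force the order below `p + 2 ^ p`, but the order is
  -- `suc p + m`.
  graph-realises : 2 ℕ.^ p ℕ.≤ m → Realises (suc p) m graph
  graph-realises 2^p≤m = record
    { order≡   = refl
    ; forced   = graph-forced
    ; code     = codewords
    ; code-ld  = codewords-ld
    ; ∣code∣≡a = ∣codewords∣
    ; minimum  = minimum
    }
    where
    minimum : ∀ C → LocatesAndDominates graph C → suc p ℕ.≤ ∣ C ∣
    minimum C ld = ℕₚ.≰⇒> λ ∣C∣≤p → ℕₚ.<⇒≱ (order<∣C∣+2^∣C∣ graph C ld) (begin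
      ∣ C ∣ ℕ.+ 2 ℕ.^ ∣ C ∣  ≤⟨ ℕₚ.+-mono-≤ ∣C∣≤p (ℕₚ.^-monoʳ-≤ 2 ∣C∣≤p) ⟩
      p ℕ.+ 2 ℕ.^ p          ≤⟨ ℕₚ.+-mono-≤ (ℕₚ.n≤1+n p) 2^p≤m ⟩
      suc p ℕ.+ m            ∎)
      where open ℕₚ.≤-Reasoning

-- Existence for every admissible pair

n<2^n : ∀ n → n ℕ.< 2 ℕ.^ n
n<2^n zero    = z<s
n<2^n (suc n) = begin-strict
  suc n                    <⟨ ℕₚ.+-mono-≤-< (ℕₚ.m^n>0 2 n) (n<2^n n) ⟩
  2 ℕ.^ n ℕ.+ 2 ℕ.^ n      ≡⟨ cong (2 ℕ.^ n ℕ.+_) (ℕₚ.+-identityʳ _) ⟨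
  2 ℕ.^ suc n              ∎
  where open ℕₚ.≤-Reasoning

largeGraph-exists : ∀ p d → 2 ℕ.^ p ℕ.≤ d → d ℕ.< 2 ℕ.^ suc p → ∃[ G ] Realises (suc p) d G
largeGraph-exists p d 2^p≤d d<2^1+p
  -- `p < 2 ^ p ≤ d` leaves room for the `suc p` prescribed traces; `extend-injection` adds the
  -- other `k`, with `⊥` as the forbidden set.
  with k , refl ← ((∃[ k ] k ℕ.+ suc p ≡ d) ∋ (_ , ℕₚ.m∸n+n≡m (ℕₚ.≤-trans (n<2^n p) 2^p≤d)))
  with F , F-inj , F≢⊥ , F⊇ ← extend-injection ⊥ almostFull almostFull-injective
         (λ i eq → ∉⊥ (subst (zero ∈_) eq (0∈almostFull i))) k d<2^1+p
  = graph , graph-realises 2^p≤d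
  where open LargeGraph F F-inj F≢⊥ (λ i → proj₁ (F⊇ i)) (λ i → proj₂ (F⊇ i))

realisable : ∀ a d → d ℕ.< 2 ℕ.^ a → ∃[ G ] Realises a d G
realisable zero    zero    _ = emptyGraph , emptyGraph-realises
realisable zero    (suc d) (s≤s ())
realisable (suc a) d       d<2^1+a with 2 ℕ.^ a ℕₚ.≤? d
... | yes 2^a≤d = largeGraph-exists a d 2^a≤d d<2^1+a
-- Here `d < 2 ^ a` is the bound required by induction, and the isolated vertex raises `a` while
-- keeping `d`.
... | no  2^a≰d with G , r ← realisable a d (ℕₚ.≰⇒> 2^a≰d) = addIsolated G , addIsolated-realises G r

∣S∣>0⇒nonempty : ∀ {n} (S : Subset n) → 0 ℕ.< ∣ S ∣ → Nonempty S
∣S∣>0⇒nonempty (inside  ∷ S) _ = zero , here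
∣S∣>0⇒nonempty (outside ∷ S) 0<∣S∣ with u , u∈S ← ∣S∣>0⇒nonempty S 0<∣S∣ = suc u , there u∈S

-- Positivity of `a` supplies the non-emptiness that `LocatesAndDominates` leaves out.
realises⇒γ : ∀ {a d G} → 0 ℕ.< a → Realises a d G → IsγLD G a × IsγSLD G (a ℕ.+ d)
realises⇒γ {a} {d} {G} 0<a r = γLD , γSLD
  where
  open Realises r
  nonempty : Nonempty code
  nonempty = ∣S∣>0⇒nonempty code (subst (0 ℕ.<_) (sym ∣code∣≡a) 0<a)

  γLD : IsγLD G a
  γLD = (code , (nonempty , code-ld) , ∣code∣≡a) , λ { C (_ , ld) → minimum C ld }

  γSLD : IsγSLD G (a ℕ.+ d)
  γSLD = (⊤ , ⊤-SLD G (proj₁ nonempty) , trans (∣⊤∣≡n _) order≡)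
       , λ C sld → subst (ℕ._≤ ∣ C ∣) order≡ (order≤SLD G forced C sld)

-- Necessity of the bounds, and the passage to integers

γLD≤γSLD : ∀ {G a b} → IsγLD G a → IsγSLD G b → a ℕ.≤ b
γLD≤γSLD {G} (_ , minimum) ((C , sld , refl) , _) = minimum C (SLD⇒LD G sld)

-- The full vertex set is self-locating-dominating, so `b` is at most the order, which the trace
-- count bounds.
γSLD<γLD+2^γLD : ∀ {G a b} → IsγLD G a → IsγSLD G b → b ℕ.< a ℕ.+ 2 ℕ.^ a
γSLD<γLD+2^γLD {G} {a} {b} ((C , ((v , _) , ld) , refl) , _) (_ , minimum) = begin-strict
  b                        ≤⟨ minimum ⊤ (⊤-SLD G v) ⟩
  ∣ ⊤ {Graph.order G} ∣    ≡⟨ ∣⊤∣≡n _ ⟩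
  Graph.order G            <⟨ order<∣C∣+2^∣C∣ G C ld ⟩
  a ℕ.+ 2 ℕ.^ a            ∎
  where open ℕₚ.≤-Reasoning

-- With `+2^a-1≡` this reduces the integer bounds to `d ≤ pred (2 ^ a)` over the naturals.
+[a+d]-+a≡+d : ∀ a d → + (a ℕ.+ d) - + a ≡ + d
+[a+d]-+a≡+d a d = begin
  + (a ℕ.+ d) - + a    ≡⟨ ℤₚ.[+m]-[+n]≡m⊖n (a ℕ.+ d) a ⟩
  (a ℕ.+ d) ⊖ a        ≡⟨ ℤₚ.⊖-≥ (ℕₚ.m≤m+n a d) ⟩
  + (a ℕ.+ d ℕ.∸ a)    ≡⟨ cong +_ (ℕₚ.m+n∸m≡n a d) ⟩
  + d                  ∎
  where open ≡-Reasoning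

+2^a-1≡ : ∀ a → + (2 ℕ.^ a) - + 1 ≡ + ℕ.pred (2 ℕ.^ a)
+2^a-1≡ a with 2 ℕ.^ a | ℕₚ.m^n>0 2 a
... | suc n | _ = refl

mainTheorem19 : (a b : ℕ) → 0 ℕ.< a → 0 ℕ.< b →
    (∃[ G ] (IsγLD G a × IsγSLD G b))
    ⇔ ((+ 0 ≤ + b - + a) × (+ b - + a ≤ + (2 ℕ.^ a) - + 1))
mainTheorem19 a b 0<a _ = mk⇔ necessary sufficient
  where
  necessary : ∃[ G ] (IsγLD G a × IsγSLD G b) →
              (+ 0 ≤ + b - + a) × (+ b - + a ≤ + (2 ℕ.^ a) - + 1)
  necessary (G , ld , sld)
    with d , refl ← ℕₚ.m≤n⇒∃[o]m+o≡n {a} {b} (γLD≤γSLD {G} ld sld)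
    rewrite +[a+d]-+a≡+d a d | +2^a-1≡ a =
    +≤+ z≤n , +≤+ (ℕₚ.<⇒≤pred (ℕₚ.+-cancelˡ-< a d (2 ℕ.^ a) (γSLD<γLD+2^γLD {G} ld sld)))

  sufficient : (+ 0 ≤ + b - + a) × (+ b - + a ≤ + (2 ℕ.^ a) - + 1) →
               ∃[ G ] (IsγLD G a × IsγSLD G b)
  sufficient (0≤b-a , b-a≤)
    with d , refl ← ℕₚ.m≤n⇒∃[o]m+o≡n {a} {b} (ℤₚ.drop‿+≤+ (ℤₚ.0≤i-j⇒j≤i {+ b} {+ a} 0≤b-a))
    rewrite +[a+d]-+a≡+d a d | +2^a-1≡ a
    with G , r ← realisable a d (ℕₚ.m≤pred[n]⇒suc[m]≤n {{ℕₚ.m^n≢0 2 a}} (ℤₚ.drop‿+≤+ b-a≤))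
    = G , realises⇒γ 0<a r
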